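{- Let $h\geq 3$ and let $H$ be a graph. The graph $G_H$ is a minimal non $[h,2,1]$ graph if and only if $H$ is $(h+1)$-critical.
   Context: All graphs are finite, simple and connected. Given a graph $H$ with $V(H)=\{v_1,\dots,v_n\}$, $G_H$ is the graph with vertex set consisting of: $v_i$ for each $1\le i\le n$; $v_{ij}$ for each $1\le i<j\le n$ with $v_iv_j\in E(H)$; and $\tilde v_i$ for each $i$ with $d_H(v_i)=1$. Its edges: the set $K_H=\{v_{ij}\}\cup\{\tilde v_i\}$ is complete; the vertices $v_1,\dots,v_n$ form a stable set; $v_i$ is adjacent to $v_{ij}$ (resp. $v_{ji}$) for each edge $v_iv_j$ of $H$ and to $\tilde v_i$ if $d_H(v_i)=1$; there are no other edges. (So the cliques of $G_H$ are $K_H$ and $C_{v_i}=\{v_i\}\cup\{v_{ij}: v_j\in N_H(v_i)\}\cup\{\tilde v_i \text{ if } d_H(v_i)=1\}$.) A VPT representation of $G$ is a tree $T$ with paths $(P_v)_{v\in V(G)}$ of $T$ such that $uv\in E(G)$ iff $P_u,P_v$ share a vertex. $[h,2,1]$ is the class of graphs admitting a VPT representation whose host tree has maximum degree at most $h$. A minimal non $[h,2,1]$ graph is a graph $G\notin[h,2,1]$ with $G-v\in[h,2,1]$ for all $v\in V(G)$. A graph with chromatic number $k$ is $k$-critical if deleting any vertex or any edge lowers the chromatic number. -}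

module Defs where

open import Data.Nat using (ℕ; zero; suc; _≤_; _<_)
open import Data.Fin using (Fin)
import Data.Fin as F
open import Data.Bool using (Bool; T)
open import Data.List using (List; []; _∷_; length; filterᵇ; _∷ʳ_; allFin)
open import Data.List.Relation.Unary.Unique.Propositional using (Unique)
open import Data.List.Relation.Unary.Linked using (Linked)
open import Data.List.Membership.Propositional using (_∈_)
open import Data.Fin.Base using (Fin)
open import Data.Product using (Σ; ∃; ∃-syntax; _×_; _,_; proj₁)
open import Data.Sum using (_⊎_)
open import Data.Empty using (⊥)
open import Data.Unit using (⊤)
open import Relation.Nullary using (¬_)
open import Relation.Binary.PropositionalEquality using (_≡_; _≢_)

record FinGraph : Set where
  field
    n      : ℕ
    adj    : Fin n → Fin n → Bool
    sym    : ∀ i j → adj i j ≡ adj j i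
    irrefl : ∀ i → ¬ T (adj i i)

module _ (H : FinGraph) where
  open FinGraph H

  deg : Fin n → ℕ
  deg i = length (filterᵇ (adj i) (allFin n))

  data Reachable : Fin n → Fin n → Set where
    here : ∀ {i} → Reachable i i
    step : ∀ {i j k} → T (adj i j) → Reachable j k → Reachable i k

  Connected : Set
  Connected = (1 ≤ n) × (∀ i j → Reachable i j)

  IsPath : List (Fin n) → Set
  IsPath xs = Unique xs × Linked (λ a b → T (adj a b)) xs

  HasCycle : Set
  HasCycle = ∃[ x ] ∃[ y ] ∃[ xs ]
    (IsPath (x ∷ (xs ∷ʳ y)) × (1 ≤ length xs) × T (adj y x))

  IsTree : Set
  IsTree = Connected × ¬ HasCycle

  MaxDegreeAtMost : ℕ → Set
  MaxDegreeAtMost h = ∀ x → deg x ≤ h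

record Graph : Set₁ where
  field
    V   : Set
    Adj : V → V → Set

open Graph public

deleteVertex : (G : Graph) → V G → Graph
deleteVertex G v = record
  { V   = Σ (V G) (λ u → u ≢ v)
  ; Adj = λ a b → Adj G (proj₁ a) (proj₁ b) }

deleteEdge : (G : Graph) → V G → V G → Graph
deleteEdge G u v = record
  { V   = V G
  ; Adj = λ a b → Adj G a b × ¬ ((a ≡ u × b ≡ v) ⊎ (a ≡ v × b ≡ u)) }

toGraph : FinGraph → Graph
toGraph H = record { V = Fin (FinGraph.n H) ; Adj = λ i j → T (FinGraph.adj H i j) }

record VPTRep (h : ℕ) (G : Graph) : Set where
  field
    T-host   : FinGraph
    isTree   : IsTree T-host
    maxDeg   : MaxDegreeAtMost T-host h
    P        : V G → List (Fin (FinGraph.n T-host))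
    nonempty : ∀ v → 1 ≤ length (P v)
    isPath   : ∀ v → IsPath T-host (P v)
    represents : ∀ u v → u ≢ v →
      (Adj G u v → ∃[ x ] (x ∈ P u × x ∈ P v)) ×
      (∃[ x ] (x ∈ P u × x ∈ P v) → Adj G u v)

In[_,2,1] : ℕ → Graph → Set
In[ h ,2,1] G = VPTRep h G

MinimalNon[_,2,1] : ℕ → Graph → Set
MinimalNon[ h ,2,1] G = ¬ In[ h ,2,1] G × (∀ v → In[ h ,2,1] (deleteVertex G v))

Colorable : Graph → ℕ → Set
Colorable G k = Σ (V G → Fin k) λ c → ∀ u v → Adj G u v → c u ≢ c v

HasChromaticNumber : Graph → ℕ → Set
HasChromaticNumber G k = Colorable G k × (∀ j → j < k → ¬ Colorable G j)

Critical : ℕ → Graph → Set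
Critical k G =
  HasChromaticNumber G k ×
  (∀ v → ∃[ j ] (j < k × HasChromaticNumber (deleteVertex G v) j)) ×
  (∀ u v → Adj G u v → ∃[ j ] (j < k × HasChromaticNumber (deleteEdge G u v) j))

module _ (H : FinGraph) where
  open FinGraph H

  data GHVertex : Set where
    vtx   : Fin n → GHVertex
    vedge : (i j : Fin n) → i F.< j → T (adj i j) → GHVertex
    vtil  : (i : Fin n) → deg H i ≡ 1 → GHVertex

  GHAdj : GHVertex → GHVertex → Set
  GHAdj (vedge i j _ _) (vedge i' j' _ _) = ¬ (i ≡ i' × j ≡ j')
  GHAdj (vedge _ _ _ _) (vtil _ _)        = ⊤
  GHAdj (vtil _ _)      (vedge _ _ _ _)   = ⊤
  GHAdj (vtil i _)      (vtil i' _)       = i ≢ i'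
  GHAdj (vtx _) (vtx _) = ⊥
  GHAdj (vtx k) (vedge i j _ _) = (k ≡ i) ⊎ (k ≡ j)
  GHAdj (vedge i j _ _) (vtx k) = (k ≡ i) ⊎ (k ≡ j)
  GHAdj (vtx k) (vtil i _) = k ≡ i
  GHAdj (vtil i _) (vtx k) = k ≡ i

  G[_] : Graph
  G[_] = record { V = GHVertex ; Adj = GHAdj }

module Submission where

-- In a representation of G[ H ] the paths of the clique K_H share a host vertex q (Helly).
-- Colouring v_i by the branch at q that contains its path is a proper h-colouring of H: a path
-- through q that meets the paths of v_i and v_j in one branch runs through one of them, say that
-- of v_i, first, and then q cannot reach the path of v_j without crossing that of v_i, whereas
-- some path of K_H meets the latter only.  Conversely an h-colouring yields a host made of
-- h caterpillars joined at a root, v_i sitting on its own leaf of the caterpillar of its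
-- colour.  Hence G[ H ] is in [h,2,1] iff H is h-colourable; the same two constructions, applied
-- after a deletion, match v_i with the deletion of a vertex of H and v_ij with that of an edge.
-- The element of K_H that meets the path of v_j only is another edge at v_j or, if v_j has
-- degree one, ṽ_j; it survives the deletion of an edge because the vertices of H then have
-- degree at least three.

open import Defs
open import Data.Bool using (Bool; true; false; T; _∨_)
open import Data.Bool.Properties using (∨-comm; T-∨; T-irrelevant)
open import Data.Empty using (⊥)
open import Data.Fin using (Fin; zero; suc; toℕ; inject₁; inject≤; fromℕ<; _<?_)
open import Data.Fin.Properties
  using (_≟_; any?; inject≤-injective; toℕ-inject₁; toℕ-injective; toℕ-fromℕ<; toℕ<n; injective⇒≤;
         <-cmp; <-asym; <-irrelevant; +↔⊎; *↔×; 1↔⊤; 2↔Bool)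
import Data.Fin.Properties as Fin
open import Data.List
  using (List; []; _∷_; _∷ʳ_; _++_; length; filterᵇ; allFin; map; concatMap; lookup; fromMaybe)
open import Data.List.Membership.DecPropositional using (_∈?_)
open import Data.List.Membership.Propositional using (_∈_; _∉_; lose)
open import Data.List.Membership.Propositional.Properties
  using (∈-filter⁺; ∈-filter⁻; ∈-lookup; ∈-allFin; ∈-map⁺; ∈-map⁻; ∈-++⁺ˡ; ∈-++⁺ʳ; ∈-concatMap⁺)
open import Data.List.Membership.Setoid.Properties using (index-injective)
open import Data.List.Properties using (length-map; length-tabulate)
open import Data.List.Relation.Unary.All as All using (All; []; _∷_)
import Data.List.Relation.Unary.All.Properties as All
open import Data.List.Relation.Unary.AllPairs using ([]; _∷_)
open import Data.List.Relation.Unary.Any as Any using (here; there)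
open import Data.List.Relation.Unary.Linked as Linked using (Linked; [-]; _∷_)
open import Data.List.Relation.Unary.Unique.Propositional using (Unique)
open import Data.List.Relation.Unary.Unique.Propositional.Properties using (filter⁺; allFin⁺)
open import Data.Maybe as Maybe using (Maybe; just; nothing)
open import Data.Maybe.Properties using (≡-dec; just-injective)
open import Data.Nat as ℕ using (ℕ; zero; suc; _+_; _*_; _≤_; _<_; z≤n; s≤s)
open import Data.Nat.Properties as ℕ
  using (≤-trans; ≤-refl; ≤-reflexive; <-irrefl; <-trans; n<1+n; suc-injective)
open import Data.Product using (Σ; ∃-syntax; _×_; _,_; proj₁; proj₂)
open import Data.Product.Function.NonDependent.Propositional using (_×-↔_)
open import Data.Sum using (_⊎_; inj₁; inj₂; [_,_]′)
open import Data.Sum.Function.Propositional using (_⊎-↔_)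
open import Data.Unit using (⊤; tt)
open import Function using (_∘_; id; _∋_)
open import Function.Bundles using (_⇔_; mk⇔; _↔_; Inverse; Equivalence)
open import Function.Construct.Composition using (_↔-∘_)
open import Function.Construct.Identity using (↔-id)
open import Relation.Binary.Definitions using (DecidableEquality; tri<; tri≈; tri>)
open import Relation.Binary.PropositionalEquality
open import Relation.Nullary using (¬_; Dec; yes; no; contradiction; T?; _×-dec_; ¬?)
open import Relation.Nullary.Decidable using (True; toWitness; fromWitness; isYes)

-- Walks and paths in trees

module Walks (G : FinGraph) where
  open FinGraph G renaming (sym to adj-sym)

  E : Fin n → Fin n → Set
  E i j = T (adj i j)

  E-sym : ∀ {i j} → E i j → E j i
  E-sym {i} {j} = subst T (adj-sym i j)

  neighbours-of : Fin n → List (Fin n)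
  neighbours-of i = filterᵇ (adj i) (allFin n)

  E⇒∈nbrs : ∀ {i j} → E i j → j ∈ neighbours-of i
  E⇒∈nbrs {i} e = ∈-filter⁺ (T? ∘ adj i) (∈-allFin _) e

  ∈nbrs⇒E : ∀ {i j} → j ∈ neighbours-of i → E i j
  ∈nbrs⇒E {i} j∈ = proj₂ (∈-filter⁻ (T? ∘ adj i) {xs = allFin n} j∈)

  -- `Q` holds at every vertex of the walk, so that avoiding a vertex or a list is a property of the
  -- type.
  data Walk (Q : Fin n → Set) : Fin n → Fin n → Set where
    stop : ∀ {a} → Q a → Walk Q a a
    step : ∀ {a b c} → Q a → E a b → Walk Q b c → Walk Q a c

  module _ {Q : Fin n → Set} where

    source : ∀ {a b} → Walk Q a b → Q a
    source (stop q)     = q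
    source (step q _ _) = q

    target : ∀ {a b} → Walk Q a b → Q b
    target (stop q)     = q
    target (step _ _ w) = target w

    infixr 5 _⁀_
    _⁀_ : ∀ {a b c} → Walk Q a b → Walk Q b c → Walk Q a c
    stop _ ⁀ v     = v
    step q e w ⁀ v = step q e (w ⁀ v)

    back : ∀ {a b} → Walk Q a b → Walk Q b a
    back (stop q)     = stop q
    back (step q e w) = back w ⁀ step (source w) (E-sym e) (stop q)

    mapWalk : ∀ {R : Fin n → Set} {a b} → (∀ {x} → Q x → R x) → Walk Q a b → Walk R a b
    mapWalk f (stop q)     = stop (f q)
    mapWalk f (step q e w) = step (f q) e (mapWalk f w)

  fromReachable : ∀ {a b} → Reachable G a b → Walk (λ _ → ⊤) a b
  fromReachable here       = stop tt
  fromReachable (step e r) = step tt e (fromReachable r)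

  toReachable : ∀ {Q a b} → Walk Q a b → Reachable G a b
  toReachable (stop _)     = here
  toReachable (step _ e w) = step e (toReachable w)

  -- Same component after the removal of `m`. In a tree its negation says that `m` lies between the
  -- two vertices.
  Joined : Fin n → Fin n → Fin n → Set
  Joined m = Walk (_≢ m)

  data Simple : Fin n → Fin n → List (Fin n) → Set where
    single : ∀ {a} → Simple a a (a ∷ [])
    cons   : ∀ {a b c L} → E a b → Simple b c L → a ∉ L → Simple a c (a ∷ L)

  module _ {Q : Fin n → Set} where

    suffix : ∀ {a b x L} → Simple a b L → All Q L → x ∈ L →
             ∃[ L′ ] (Simple x b L′ × All Q L′)
    suffix single         qs       (here refl) = _ , single , qs
    suffix s@(cons _ _ _) qs       (here refl) = _ , s , qs
    suffix (cons _ s _)   (_ ∷ qs) (there x∈)  = suffix s qs x∈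

    -- Loop erasure: if the new first vertex occurs later, everything before that occurrence is
    -- dropped.
    erase : ∀ {a b} → Walk Q a b → ∃[ L ] (Simple a b L × All Q L)
    erase (stop q) = _ , single , q ∷ []
    erase {a} (step q e w) with erase w
    ... | L , s , qs with _∈?_ _≟_ a L
    ...   | yes a∈ = suffix s qs a∈
    ...   | no  a∉ = a ∷ L , cons e s a∉ , q ∷ qs

  head∈ : ∀ {a b L} → Simple a b L → a ∈ L
  head∈ single       = here refl
  head∈ (cons _ _ _) = here refl

  last∈ : ∀ {a b L} → Simple a b L → b ∈ L
  last∈ single       = here refl
  last∈ (cons _ s _) = there (last∈ s)

  Simple⇒IsPath : ∀ {a b L} → Simple a b L → IsPath G L
  Simple⇒IsPath single = [] ∷ [] , [-]
  Simple⇒IsPath (cons e s a∉) with Simple⇒IsPath s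
  ... | u , l = All.¬Any⇒All¬ _ a∉ ∷ u , linked e s l
    where
    linked : ∀ {a b c L} → E a b → Simple b c L → Linked E L → Linked E (a ∷ L)
    linked e single       l = e ∷ l
    linked e (cons _ _ _) l = e ∷ l

  Simple-snoc : ∀ {a b L} → Simple a b L → ∃[ L′ ] L ≡ L′ ∷ʳ b
  Simple-snoc single = [] , refl
  Simple-snoc {a} (cons _ s _) with Simple-snoc s
  ... | L′ , refl = a ∷ L′ , refl

  linkedWalk : ∀ {Q x y L} → Linked E (x ∷ L) → All Q (x ∷ L) → y ∈ x ∷ L → Walk Q x y
  linkedWalk l       (q ∷ _)  (here refl) = stop q
  linkedWalk (e ∷ l) (q ∷ qs) (there y∈)  = step q e (linkedWalk l qs y∈)

  ∉⇒All≢ : ∀ {m : Fin n} {L} → m ∉ L → All (_≢ m) L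
  ∉⇒All≢ m∉ = All.map (λ m≢ x≡m → m≢ (sym x≡m)) (All.¬Any⇒All¬ _ m∉)

  pathJoined : ∀ {L a b m} → IsPath G L → a ∈ L → b ∈ L → m ∉ L → Joined m a b
  pathJoined {_ ∷ _} (_ , l) a∈ b∈ m∉ =
    back (linkedWalk l (∉⇒All≢ m∉) a∈) ⁀ linkedWalk l (∉⇒All≢ m∉) b∈

  -- The tail is searched first, so the exit found follows the last visit to `m`, and the rest of
  -- the walk avoids `m`.
  lastExit : ∀ {Q a b} m → b ≢ m → Walk Q a b →
             Joined m a b ⊎ ∃[ y ] (E m y × Q y × Joined m y b)
  lastExit m b≢m (stop _) = inj₁ (stop b≢m)
  lastExit {a = a} m b≢m (step _ e w) with lastExit m b≢m w
  ... | inj₂ exit = inj₂ exit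
  ... | inj₁ v with a ≟ m
  ...   | yes refl = inj₂ (_ , e , source w , v)
  ...   | no a≢m   = inj₁ (step a≢m e v)

  firstEntry : ∀ {Q a b} S → a ∉ S → b ∈ S → Walk Q a b →
               ∃[ y ] ∃[ m ] (Walk (_∉ S) a y × E y m × m ∈ S)
  firstEntry S a∉ b∈ (stop _) = contradiction b∈ a∉
  firstEntry S a∉ b∈ (step {b = c} _ e w) with _∈?_ _≟_ c S
  ... | yes c∈ = _ , _ , stop a∉ , e , c∈
  ... | no  c∉ with firstEntry S c∉ b∈ w
  ...   | y , m , v , e′ , m∈ = y , m , step a∉ e v , e′ , m∈

  -- Separation, betweenness and the Helly property in trees

  module _ (tree : IsTree G) where

    connected : ∀ a b → Walk (λ _ → ⊤) a b
    connected a b = fromReachable (proj₂ (proj₁ tree) a b)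

    -- A simple path from `y` to `z` avoiding `q` would be closed to a cycle by `q`.
    neighbours-separated : ∀ {q y z} → E q y → E q z → y ≢ z → ¬ Joined q y z
    neighbours-separated {q} {y} {z} qy qz y≢z w with erase w
    ... | _ , single , _ = y≢z refl
    ... | _ , s@(cons yb t y∉) , qs@(_ ∷ _) with Simple-snoc t
    ...   | L′ , refl = proj₂ tree
            (q , z , y ∷ L′ , Simple⇒IsPath (cons qy s q∉) , s≤s z≤n , E-sym qz)
      where
      q∉ : q ∉ y ∷ (L′ ∷ʳ z)
      q∉ = All.All¬⇒¬Any (All.map (λ x≢q q≡x → x≢q (sym q≡x)) qs)

    -- A walk from `m` to `b` avoiding `y` leaves `m` for the last time through a neighbour other
    -- than `y`; via `b` that neighbour would be joined to `y` without passing `m`.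
    edge-separated : ∀ {y m b} → E y m → Joined m y b → ¬ Joined y m b
    edge-separated ym my ym′ with lastExit _ (target my) ym′
    ... | inj₁ w = source w refl
    ... | inj₂ (y′ , e , y′≢y , w) =
      neighbours-separated e (E-sym ym) y′≢y (w ⁀ back my)

    adjacent-middle : ∀ {x y L z} → IsPath G (x ∷ y ∷ L) → z ∈ L → ¬ Joined y x z
    adjacent-middle {L = u ∷ L} ((x∉ ∷ y∉ ∷ _) , (xy ∷ yu ∷ l)) z∈ w =
      neighbours-separated (E-sym xy) yu (All.lookup x∉ (there (here refl)))
        (w ⁀ back (linkedWalk l (All.map (λ p e → p (sym e)) y∉) z∈))

    -- Whichever of `y` and `z` is nearer to `x` separates `x` from the other. If neither is next on
    -- the path, the head moves on by one and both walks are extended by the edge back to `x`.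
    from-end : ∀ {x y z L} → IsPath G (x ∷ L) → y ∈ L → z ∈ L → y ≢ z →
               Joined y x z → ¬ Joined z x y
    from-end p (here refl) (here refl) y≢z _ _ = y≢z refl
    from-end p (here refl) (there z∈)  _   a _ = adjacent-middle p z∈ a
    from-end p (there y∈)  (here refl) _   _ b = adjacent-middle p y∈ b
    from-end ((_ ∷ (w∉ ∷ u)) , (e ∷ l)) (there y∈) (there z∈) y≢z a b =
      from-end (w∉ ∷ u , l) y∈ z∈ y≢z
        (step (All.lookup w∉ y∈) (E-sym e) a) (step (All.lookup w∉ z∈) (E-sym e) b)

    -- One of three distinct vertices of a path lies between the other two.
    path-betweenness : ∀ {L x y z} → IsPath G L → x ∈ L → y ∈ L → z ∈ L →
      x ≢ y → x ≢ z → y ≢ z → Joined x y z → Joined y x z → ¬ Joined z x y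
    path-betweenness p (here refl) (here refl) _ x≢y _ _ = contradiction refl x≢y
    path-betweenness p (here refl) _ (here refl) _ x≢z _ = contradiction refl x≢z
    path-betweenness p _ (here refl) (here refl) _ _ y≢z = contradiction refl y≢z
    path-betweenness p (here refl) (there y∈) (there z∈) _ _ y≢z a b c =
      from-end p y∈ z∈ y≢z b c
    path-betweenness p (there x∈) (here refl) (there z∈) _ x≢z _ a b c =
      from-end p x∈ z∈ x≢z a (back c)
    path-betweenness p (there x∈) (there y∈) (here refl) x≢y _ _ a b c =
      from-end p x∈ y∈ x≢y (back a) (back b)
    path-betweenness ((_ ∷ u) , l) (there x∈) (there y∈) (there z∈) =
      path-betweenness (u , Linked.tail l) x∈ y∈ z∈

    -- Induction on the list. If the point `q` common to the other paths is not on `p`, the first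
    -- vertex `m` of `p` on a walk from `q` to `p` serves: a path through `q` that meets `p` but
    -- misses `m` would bypass the edge by which the walk enters `p`.
    helly : ∀ (Ps : List (List (Fin n))) → All (IsPath G) Ps →
            (∀ {p p′} → p ∈ Ps → p′ ∈ Ps → ∃[ x ] (x ∈ p × x ∈ p′)) →
            ∃[ q ] All (q ∈_) Ps
    helly [] _ _ = fromℕ< (proj₁ (proj₁ tree)) , []
    helly (p ∷ Ps) (pp ∷ pps) meet
      with helly Ps pps (λ a b → meet (there a) (there b))
    ... | q , q∈s with _∈?_ _≟_ q p
    ...   | yes q∈p = q , q∈p ∷ q∈s
    ...   | no  q∉p with meet (here refl) (here refl)
    ...     | a , a∈p , _ with firstEntry p q∉p a∈p (connected q a)
    ...       | y , m , w , ym , m∈p = m , m∈p ∷ All.tabulate m∈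
      where
      m∈ : ∀ {p′} → p′ ∈ Ps → m ∈ p′
      m∈ {p′} p′∈ with _∈?_ _≟_ m p′
      ... | yes m∈p′ = m∈p′
      ... | no  m∉p′ with meet (here refl) (there p′∈)
      ...   | b , b∈p , b∈p′ = contradiction (pathJoined pp m∈p b∈p (target w))
        (edge-separated ym
          (back (mapWalk (λ { x∉ refl → x∉ m∈p }) w)
            ⁀ pathJoined (All.lookup pps p′∈) (All.lookup q∈s p′∈) b∈p′ m∉p′))

    module _ {h} (deg≤h : MaxDegreeAtMost G h) (q : Fin n) where

      label : ∀ {y} → E q y → Fin h
      label e = inject≤ (Any.index (E⇒∈nbrs e)) (deg≤h q)

      label-injective : ∀ {y z} (e : E q y) (f : E q z) → label e ≡ label f → y ≡ z
      label-injective e f eq =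
        index-injective (setoid _) (E⇒∈nbrs e) (E⇒∈nbrs f) (inject≤-injective _ _ _ _ eq)

      branch : ∀ p → 1 ≤ length p → 1 ≤ h → ∃[ c ] (q ∉ p →
               ∃[ x ] ∃[ y ] (x ∈ p × Joined q y x × ∃[ e ] c ≡ label {y} e))
      branch (x ∷ p) _ _ with x ≟ q
      -- A placeholder colour: a path containing `q` lies in no single branch, and nothing is
      -- claimed about it.
      branch (x ∷ p) _ (s≤s _) | yes refl = zero , λ q∉ → contradiction (here refl) q∉
      branch (x ∷ p) _ _ | no x≢q with lastExit q x≢q (connected q x)
      ... | inj₁ w = contradiction refl (source w)
      ... | inj₂ (y , e , _ , w) = label e , λ _ → x , y , here refl , w , e , refl

-- Colourings from representations

module _ {h G} (rep : VPTRep h G) where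
  open VPTRep rep
  open Walks T-host

  adjacent⇒meet : ∀ {u v} → u ≢ v → Adj G u v → ∃[ x ] (x ∈ P u × x ∈ P v)
  adjacent⇒meet {u} {v} u≢v = proj₁ (represents u v u≢v)

  meet⇒adjacent : ∀ {u v x} → u ≢ v → x ∈ P u → x ∈ P v → Adj G u v
  meet⇒adjacent {u} {v} u≢v a b = proj₂ (represents u v u≢v) (_ , a , b)

  -- Colour b by the branch, at a common vertex q of the clique I, that contains the path of β b.
  branchColouring :
    1 ≤ h →
    {I : Set} (ϕ : I → V G) (is : List I) (listed : ∀ i → i ∈ is)
    (clique : ∀ i j → ϕ i ≡ ϕ j ⊎ (ϕ i ≢ ϕ j × Adj G (ϕ i) (ϕ j)))
    (B : Graph) (B-sym : ∀ {b c} → Adj B b c → Adj B c b)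
    (β : V B → V G) (β≢ϕ : ∀ b i → ϕ i ≢ β b)
    (stable : ∀ {b c} → Adj B b c → β b ≢ β c × ¬ Adj G (β b) (β c))
    (common : ∀ {b c} → Adj B b c → ∃[ i ] (Adj G (ϕ i) (β b) × Adj G (ϕ i) (β c)))
    (exclusive : ∀ {b c} → Adj B b c → ∃[ i ] (Adj G (ϕ i) (β c) × ¬ Adj G (ϕ i) (β b))) →
    Colorable B h
  branchColouring 1≤h ϕ is listed clique B B-sym β β≢ϕ stable common exclusive =
    colour , proper
    where
    meet : ∀ i j → ∃[ x ] (x ∈ P (ϕ i) × x ∈ P (ϕ j))
    meet i j with clique i j
    ... | inj₂ (i≢j , a) = adjacent⇒meet i≢j a
    -- Two indices with the same image share a path, and its first vertex is common to both.
    ... | inj₁ eq with P (ϕ i) | P (ϕ j) | cong P eq | nonempty (ϕ i)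
    ...   | x ∷ _ | _ | refl | _ = x , here refl , here refl

    meets : ∀ {p p′} → p ∈ map (P ∘ ϕ) is → p′ ∈ map (P ∘ ϕ) is → ∃[ x ] (x ∈ p × x ∈ p′)
    meets p∈ p′∈ with ∈-map⁻ (P ∘ ϕ) p∈ | ∈-map⁻ (P ∘ ϕ) p′∈
    ... | i , _ , refl | j , _ , refl = meet i j

    centre : ∃[ q ] All (q ∈_) (map (P ∘ ϕ) is)
    centre = helly isTree _ (All.map⁺ (All.universal (isPath ∘ ϕ) is)) meets

    q : Fin _
    q = proj₁ centre

    q∈ : ∀ i → q ∈ P (ϕ i)
    q∈ i = All.lookup (proj₂ centre) (∈-map⁺ (P ∘ ϕ) (listed i))

    branchOf : ∀ b → _
    branchOf b = branch isTree maxDeg q (P (β b)) (nonempty (β b)) 1≤h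

    colour : V B → Fin h
    colour b = proj₁ (branchOf b)

    avoids : ∀ {b i x} → ¬ Adj G (ϕ i) (β b) → x ∈ P (ϕ i) → x ∉ P (β b)
    avoids {b} {i} ¬a x∈ x∈′ = ¬a (meet⇒adjacent (β≢ϕ b i) x∈ x∈′)

    -- A vertex a of P (β b) cannot separate q from P (β c): the path of f goes around it.
    around : ∀ {b c a d} → Adj B b c → a ∈ P (β b) → d ∈ P (β c) → Joined a q d
    around {b} {c} bc a∈ d∈ with exclusive bc
    ... | f , fc , ¬fb with adjacent⇒meet (β≢ϕ c f) fc
    ...   | d′ , d′∈f , d′∈ =
      pathJoined (isPath (ϕ f)) (q∈ f) d′∈f (λ a∈f → avoids {i = f} ¬fb a∈f a∈)
      ⁀ pathJoined (isPath (β c)) d′∈ d∈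
          (λ a∈′ → proj₂ (stable bc) (meet⇒adjacent (proj₁ (stable bc)) a∈ a∈′))

    q∉ : ∀ {b c} → Adj B b c → q ∉ P (β b)
    q∉ bc with exclusive bc
    ... | f , _ , ¬fb = avoids {i = f} ¬fb (q∈ f)

    proper : ∀ b c → Adj B b c → colour b ≢ colour c
    proper b c bc same
      with proj₂ (branchOf b) (q∉ bc) | proj₂ (branchOf c) (q∉ (B-sym bc)) | common bc
    ... | x , y , x∈ , yx , e , eq | x′ , y′ , x′∈ , y′x′ , e′ , eq′ | i , ib , ic
      with label-injective isTree maxDeg q e e′ (trans (sym eq) (trans same eq′))
         | adjacent⇒meet (β≢ϕ b i) ib | adjacent⇒meet (β≢ϕ c i) ic
    ... | refl | a , a∈i , a∈ | d , d∈i , d∈ =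
      -- None of `q`, `a`, `d` lies between the other two: `a` and `d` share a branch at `q`, and
      -- `around` joins `q` to each of them past the other. Yet all three are on the path of `ϕ i`.
      path-betweenness isTree (isPath (ϕ i)) (q∈ i) a∈i d∈i
        (λ { refl → q∉ bc a∈ }) (λ { refl → q∉ (B-sym bc) d∈ })
        (λ { refl → proj₂ (stable bc) (meet⇒adjacent (proj₁ (stable bc)) a∈ d∈) })
        (pathJoined (isPath (β b)) a∈ x∈ (q∉ bc) ⁀ back yx ⁀ y′x′
          ⁀ pathJoined (isPath (β c)) x′∈ d∈ (q∉ (B-sym bc)))
        (around bc a∈ d∈) (around (B-sym bc) d∈ a∈)

-- Host trees from colourings

lookup-injective : ∀ {A : Set} {xs : List A} → Unique xs →
                   ∀ {i j} → lookup xs i ≡ lookup xs j → i ≡ j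
lookup-injective (_  ∷ _) {zero}  {zero}  _  = refl
lookup-injective (x∉ ∷ _) {zero}  {suc j} eq = contradiction eq (All.lookup x∉ (∈-lookup j))
lookup-injective (x∉ ∷ _) {suc i} {zero}  eq = contradiction (sym eq) (All.lookup x∉ (∈-lookup i))
lookup-injective (_  ∷ u) {suc i} {suc j} eq = cong suc (lookup-injective u eq)

unique-length : ∀ {A : Set} {xs ys : List A} → Unique xs →
                (∀ {x} → x ∈ xs → x ∈ ys) → length xs ≤ length ys
unique-length u sub = injective⇒≤ λ {i} {j} eq → lookup-injective u
  (index-injective (setoid _) (sub (∈-lookup i)) (sub (∈-lookup j)) eq)

deg≤ : ∀ G i (L : List (Fin (FinGraph.n G))) → (∀ {j} → T (FinGraph.adj G i j) → j ∈ L) →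
       deg G i ≤ length L
deg≤ G i L covers =
  unique-length (filter⁺ (T? ∘ FinGraph.adj G i) (allFin⁺ _)) (covers ∘ Walks.∈nbrs⇒E G)

-- `Up i j` makes `j` the parent of `i`, and `level` is the depth; each edge joins a vertex to its
-- only parent.
module Forest (G : FinGraph)
  (Up : Fin (FinGraph.n G) → Fin (FinGraph.n G) → Set) (level : Fin (FinGraph.n G) → ℕ)
  (orient : ∀ {i j} → T (FinGraph.adj G i j) → Up i j ⊎ Up j i)
  (Up-level : ∀ {i j} → Up i j → level j < level i)
  (Up-unique : ∀ {i j k} → Up i j → Up i k → j ≡ k)
  where
  open FinGraph G using (n)

  -- A path that has gone down once keeps going down.
  descends : ∀ {a b} L {y} → IsPath G (a ∷ b ∷ (L ∷ʳ y)) → Up b a →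
             level b < level y × ∃[ w ] (w ∈ b ∷ L × Up y w)
  descends [] (((_ ∷ a≢y ∷ _) ∷ _) , (_ ∷ by ∷ _)) up with orient by
  ... | inj₁ by = contradiction (Up-unique up by) a≢y
  ... | inj₂ yb = Up-level yb , _ , here refl , yb
  descends (c ∷ L) (((_ ∷ a≢c ∷ _) ∷ u) , (_ ∷ l@(bc ∷ _))) up with orient bc
  ... | inj₁ bc = contradiction (Up-unique up bc) a≢c
  ... | inj₂ cb with descends L (u , l) cb
  ...   | lt , w , w∈ , yw = <-trans (Up-level cb) lt , w , there w∈ , yw

  -- Either every edge climbs, and the level drops throughout, or `descends` applies from the first
  -- edge that goes down.
  climbs-or-descends : ∀ a L {y} → IsPath G (a ∷ (L ∷ʳ y)) →
    level y < level a ⊎ ∃[ w ] (w ∈ a ∷ L × Up y w)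
  climbs-or-descends a [] (_ , (ay ∷ _)) with orient ay
  ... | inj₁ ay = inj₁ (Up-level ay)
  ... | inj₂ ya = inj₂ (_ , here refl , ya)
  climbs-or-descends a (b ∷ L) p@((_ ∷ u) , (ab ∷ l)) with orient ab
  ... | inj₂ ba = let _ , w , w∈ , yw = descends L p ba in inj₂ (w , there w∈ , yw)
  ... | inj₁ ab with climbs-or-descends b L (u , l)
  ...   | inj₁ lt             = inj₁ (<-trans lt (Up-level ab))
  ...   | inj₂ (w , w∈ , yw) = inj₂ (w , there w∈ , yw)

  ∈-last : ∀ {L : List (Fin n)} {y} → y ∈ L ∷ʳ y
  ∈-last {[]}    = here refl
  ∈-last {_ ∷ L} = there (∈-last {L})

  ∈-init : ∀ {L : List (Fin n)} {x y} → x ∈ L → x ∈ L ∷ʳ y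
  ∈-init (here refl) = here refl
  ∈-init (there x∈)  = there (∈-init x∈)

  -- The closing edge gives `x` or `y` a second parent or contradicts the levels.
  acyclic : ¬ HasCycle G
  acyclic (x , y , z ∷ L , p@((x∉ ∷ z∉ ∷ u) , (xz ∷ l)) , _ , yx)
    with orient xz
  ... | inj₂ zx = down (descends L p zx) (orient yx)
    where
    down : level z < level y × ∃[ w ] (w ∈ z ∷ L × Up y w) → Up y x ⊎ Up x y → ⊥
    down (_ , w , w∈ , yw) (inj₁ yx) = All.lookup x∉ (∈-init w∈) (Up-unique yx yw)
    down (lt , _) (inj₂ xy) = <-irrefl refl (<-trans (<-trans lt (Up-level xy)) (Up-level zx))
  ... | inj₁ xz = up (climbs-or-descends z L (z∉ ∷ u , l)) (orient yx)
    where
    up : level y < level z ⊎ ∃[ w ] (w ∈ z ∷ L × Up y w) → Up y x ⊎ Up x y → ⊥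
    up _ (inj₂ xy) = All.lookup z∉ (∈-last {L}) (Up-unique xz xy)
    up (inj₁ lt) (inj₁ yx) = <-irrefl refl (<-trans (<-trans lt (Up-level xz)) (Up-level yx))
    up (inj₂ (w , w∈ , yw)) (inj₁ yx) = All.lookup x∉ (∈-init w∈) (Up-unique yx yw)

-- Built from sums and products so that the standard bijections of finite types number the nodes.
Node : ℕ → ℕ → Set
Node h m = ⊤ ⊎ (Fin h × (Fin m × Bool))

pattern root      = inj₁ tt
pattern spine c k = inj₂ (c , (k , false))
pattern leaf c k  = inj₂ (c , (k , true))

-- Vertex k of H will sit on leaf c k, where c is its colour; the leaves of the other colours stay
-- unused, so that the host does not depend on the colouring.
module Caterpillars (h m : ℕ) where

  N : ℕ
  N = 1 + h * (m * 2)

  -- Opaque, so that `encode` and `decode` never unfold; only the two inverse laws are used.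
  abstract
    coding : Fin N ↔ Node h m
    coding = (1↔⊤ ⊎-↔ ((↔-id _ ×-↔ ((↔-id _ ×-↔ 2↔Bool) ↔-∘ *↔×)) ↔-∘ *↔×)) ↔-∘ +↔⊎

  open Inverse coding using () renaming
    (to to decode; from to encode;
     strictlyInverseˡ to decode-encode; strictlyInverseʳ to encode-decode) public

  encode-injective : ∀ {x y} → encode x ≡ encode y → x ≡ y
  encode-injective {x} {y} eq =
    trans (sym (decode-encode x)) (trans (cong decode eq) (decode-encode y))

  parent : Node h m → Maybe (Node h m)
  parent root              = nothing
  parent (leaf c k)        = just (spine c k)
  parent (spine c zero)    = just root
  parent (spine c (suc k)) = just (spine c (inject₁ k))

  height : Node h m → ℕ
  height root        = 0
  height (spine c k) = suc (toℕ k)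
  height (leaf c k)  = 2 + toℕ k

  parent-height : ∀ {x y} → parent x ≡ just y → height y < height x
  parent-height {leaf c k}        refl = ≤-refl
  parent-height {spine c zero}    refl = s≤s z≤n
  parent-height {spine c (suc k)} refl = s≤s (s≤s (≤-reflexive (toℕ-inject₁ k)))

  up : Fin N → Maybe (Fin N)
  up i = Maybe.map encode (parent (decode i))

  up? : ∀ i j → Dec (up i ≡ just j)
  up? i j = ≡-dec _≟_ (up i) (just j)

  up-decode : ∀ {i j} → up i ≡ just j → parent (decode i) ≡ just (decode j)
  up-decode {i} eq with parent (decode i)
  up-decode refl | just y = cong just (sym (decode-encode y))

  up-height : ∀ {i j} → up i ≡ just j → height (decode j) < height (decode i)
  up-height = parent-height ∘ up-decode

  host : FinGraph
  host = record
    { n      = N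
    ; adj    = λ i j → isYes (up? i j) ∨ isYes (up? j i)
    ; sym    = λ i j → ∨-comm (isYes (up? i j)) (isYes (up? j i))
    ; irrefl = λ i a → [ loop , loop ]′ (Equivalence.to T-∨ a)
    }
    where
    loop : ∀ {i} → ¬ True (up? i i)
    loop {i} t = <-irrefl refl (up-height {i} (toWitness t))

  open FinGraph host using (adj)
  open Walks host

  orient : ∀ {i j} → T (adj i j) → up i ≡ just j ⊎ up j ≡ just i
  orient {i} {j} a with Equivalence.to (T-∨ {isYes (up? i j)}) a
  ... | inj₁ t = inj₁ (toWitness {a? = up? i j} t)
  ... | inj₂ t = inj₂ (toWitness {a? = up? j i} t)

  parent-adj : ∀ {x y} → parent x ≡ just y → T (adj (encode x) (encode y))
  parent-adj {x} {y} eq = Equivalence.from (T-∨ {isYes (up? _ _)}) (inj₁ (fromWitness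
    (trans (cong (Maybe.map encode ∘ parent) (decode-encode x)) (cong (Maybe.map encode) eq))))

  next : Fin m → Fin m
  next k with suc (toℕ k) ℕ.<? m
  ... | yes lt = fromℕ< lt
  -- The last spine vertex has no successor. Returning `k` merely pads `children`, which has to
  -- cover the children and may contain more.
  ... | no _   = k

  next-suc : ∀ {k l : Fin m} → toℕ l ≡ suc (toℕ k) → l ≡ next k
  next-suc {k} {l} eq with suc (toℕ k) ℕ.<? m
  ... | yes lt = toℕ-injective (trans eq (sym (toℕ-fromℕ< lt)))
  ... | no ¬lt = contradiction (subst (_< m) eq (toℕ<n l)) ¬lt

  -- Spines have a first vertex only for positive `m`; `m` is an argument here so that it can be
  -- split.
  firsts : ∀ h m → List (Node h m)
  firsts h zero    = []
  firsts h (suc m) = map (λ c → spine c zero) (allFin h)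

  firsts-length : ∀ h m → length (firsts h m) ≤ h
  firsts-length h zero    = z≤n
  firsts-length h (suc m) =
    ≤-reflexive (trans (length-map _ (allFin h)) (length-tabulate _))

  children : Node h m → List (Node h m)
  children root        = firsts h m
  children (spine c k) = spine c (next k) ∷ leaf c k ∷ []
  children (leaf c k)  = []

  children-complete : ∀ {x} y → parent y ≡ just x → y ∈ children x
  children-complete (leaf c k)        refl = there (here refl)
  children-complete (spine c zero)    refl = firsts-complete c
    where
    firsts-complete : ∀ {h m} c → spine c zero ∈ firsts h (suc m)
    firsts-complete c = ∈-map⁺ (λ c → spine c zero) (∈-allFin c)
  children-complete (spine c (suc k)) refl =
    here (cong (spine c) (next-suc (cong suc (sym (toℕ-inject₁ k)))))

  incident : Node h m → List (Node h m)
  incident x = fromMaybe (parent x) ++ children x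

  -- The root has at most one child per colour. A spine vertex has at most three neighbours: its
  -- parent, its successor and its leaf.
  incident-length : 3 ≤ h → ∀ x → length (incident x) ≤ h
  incident-length _   root              = firsts-length h m
  incident-length 3≤h (leaf c k)        = ≤-trans (s≤s z≤n) 3≤h
  incident-length 3≤h (spine c zero)    = 3≤h
  incident-length 3≤h (spine c (suc k)) = 3≤h

  maxDegree : 3 ≤ h → MaxDegreeAtMost host h
  maxDegree 3≤h i = ≤-trans (deg≤ host i (map encode (incident (decode i))) covers)
    (≤-trans (≤-reflexive (length-map encode (incident (decode i)))) (incident-length 3≤h (decode i)))
    where
    covers : ∀ {j} → T (adj i j) → j ∈ map encode (incident (decode i))
    covers {j} a = subst (_∈ map encode (incident (decode i))) (encode-decode j)
      (∈-map⁺ encode (neighbour (orient a)))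
      where
      neighbour : up i ≡ just j ⊎ up j ≡ just i → decode j ∈ incident (decode i)
      neighbour (inj₁ eq) = ∈-++⁺ˡ (∈-fromMaybe (up-decode eq))
        where
        ∈-fromMaybe : ∀ {x : Node h m} {y} → y ≡ just x → x ∈ fromMaybe y
        ∈-fromMaybe refl = here refl
      neighbour (inj₂ eq) = ∈-++⁺ʳ (fromMaybe (parent (decode i)))
        (children-complete (decode j) (up-decode eq))

  -- Bounds the arm from the root to the tip of `k`; regions of different colours share only the
  -- root. The colour `nothing` is for a vertex deleted from `H`, whose arm shrinks to the root.
  region : Maybe (Fin h) → Fin m → Node h m → Set
  region a k root        = ⊤
  region a k (leaf c l)  = a ≡ just c × l ≡ k
  region a k (spine c l) = a ≡ just c

  tip : Maybe (Fin h) → Fin m → Node h m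
  tip nothing  k = root
  tip (just c) k = leaf c k

  Region : Maybe (Fin h) → Fin m → Fin N → Set
  Region a k = region a k ∘ decode

  region-encode : ∀ {a k} x → region a k x → Region a k (encode x)
  region-encode {a} {k} x = subst (region a k) (sym (decode-encode x))

  arm : ∀ a k → Walk (Region a k) (encode (tip a k)) (encode root)
  arm nothing  k = stop (region-encode root tt)
  arm (just c) k = step (region-encode (leaf c k) (refl , refl)) (parent-adj refl) (along _ k refl)
    where
    -- Recursion on the position `d`, as `inject₁ l` is not a subterm of `suc l`.
    along : ∀ d l → toℕ l ≡ d → Walk (Region (just c) k) (encode (spine c l)) (encode root)
    along d zero _ = step (region-encode (spine c zero) refl) (parent-adj refl)
      (stop (region-encode root tt))
    along (suc d) (suc l) eq = step (region-encode (spine c (suc l)) refl) (parent-adj refl)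
      (along d (inject₁ l) (trans (toℕ-inject₁ l) (suc-injective eq)))

  host-tree : IsTree host
  host-tree = (s≤s z≤n , λ i j → toReachable (toRoot i ⁀ back (toRoot j))) , acyclic
    where
    open Forest host (λ i j → up i ≡ just j) (height ∘ decode) orient up-height
      (λ p q → just-injective (trans (sym p) q))

    node : ∀ x → Walk (λ _ → ⊤) (encode x) (encode root)
    node root        = stop tt
    node (leaf c k)  = mapWalk _ (arm (just c) k)
    -- A detour through the leaf, in order to reuse `arm`.
    node (spine c k) = step tt (E-sym (parent-adj refl)) (node (leaf c k))

    toRoot : ∀ i → Walk (λ _ → ⊤) i (encode root)
    toRoot i = subst (λ j → Walk (λ _ → ⊤) j (encode root)) (encode-decode i) (node (decode i))

-- Concatenation of simple paths

module Gluing (G : FinGraph) where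
  open FinGraph G using (n)
  open Walks G

  -- Both lists contain the junction; it is kept once.
  glue : List (Fin n) → List (Fin n) → List (Fin n)
  glue []          M = M
  glue (x ∷ [])    M = M
  glue (x ∷ y ∷ L) M = x ∷ glue (y ∷ L) M

  ∈-glue⁻ : ∀ {x} L {M} → x ∈ glue L M → x ∈ L ⊎ x ∈ M
  ∈-glue⁻ []          x∈          = inj₂ x∈
  ∈-glue⁻ (_ ∷ [])    x∈          = inj₂ x∈
  ∈-glue⁻ (_ ∷ _ ∷ _) (here refl) = inj₁ (here refl)
  ∈-glue⁻ (_ ∷ y ∷ L) (there x∈) with ∈-glue⁻ (y ∷ L) x∈
  ... | inj₁ x∈L = inj₁ (there x∈L)
  ... | inj₂ x∈M = inj₂ x∈M

  ∈-glueʳ : ∀ {x} L {M} → x ∈ M → x ∈ glue L M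
  ∈-glueʳ []          x∈ = x∈
  ∈-glueʳ (_ ∷ [])    x∈ = x∈
  ∈-glueʳ (_ ∷ y ∷ L) x∈ = there (∈-glueʳ (y ∷ L) x∈)

  ∈-glueˡ : ∀ {a q b x L M} → Simple a q L → Simple q b M → x ∈ L → x ∈ glue L M
  ∈-glueˡ single t (here refl) = head∈ t
  ∈-glueˡ (cons _ single _)         t (here refl) = here refl
  ∈-glueˡ (cons _ (cons _ _ _) _)   t (here refl) = here refl
  ∈-glueˡ (cons _ s@single _)       t (there x∈)  = there (∈-glueˡ s t x∈)
  ∈-glueˡ (cons _ s@(cons _ _ _) _) t (there x∈)  = there (∈-glueˡ s t x∈)

  glue-simple : ∀ {a q b L M} → Simple a q L → Simple q b M →
                (∀ {x} → x ∈ L → x ∈ M → x ≡ q) → Simple a b (glue L M)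
  glue-simple single t _ = t
  glue-simple {a} (cons {L = L@(_ ∷ _)} e s a∉) t meet =
    cons e (glue-simple s t (meet ∘ there)) a∉glue
    where
    a∉glue : a ∉ glue L _
    a∉glue a∈ with ∈-glue⁻ L a∈
    ... | inj₁ a∈L = a∉ a∈L
    ... | inj₂ a∈M with meet (here refl) a∈M
    ...   | refl = a∉ (last∈ s)

-- Representing `G[ H ]` and its vertex-deleted subgraphs

module _ (H : FinGraph) where
  open FinGraph H using (n; adj)

  -- With `id` this is `G[ H ]` and with `proj₁` a vertex-deleted subgraph, both definitionally.
  pullback : {A : Set} → (A → GHVertex H) → Graph
  pullback {A} ι = record { V = A ; Adj = λ a b → GHAdj H (ι a) (ι b) }

  GHAdj-sym : ∀ u v → GHAdj H u v → GHAdj H v u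
  GHAdj-sym (vtx _)         (vedge _ _ _ _) a = a
  GHAdj-sym (vtx _)         (vtil _ _)      a = a
  GHAdj-sym (vedge _ _ _ _) (vtx _)         a = a
  GHAdj-sym (vedge _ _ _ _) (vedge _ _ _ _) a = λ { (refl , refl) → a (refl , refl) }
  GHAdj-sym (vedge _ _ _ _) (vtil _ _)      a = a
  GHAdj-sym (vtil _ _)      (vtx _)         a = a
  GHAdj-sym (vtil _ _)      (vedge _ _ _ _) a = a
  GHAdj-sym (vtil _ _)      (vtil _ _)      a = a ∘ sym

  InK : GHVertex H → Set
  InK (vtx _)         = ⊥
  InK (vedge _ _ _ _) = ⊤
  InK (vtil _ _)      = ⊤

  vedge-cong : ∀ {i j i′ j′ p q p′ q′} → i ≡ i′ → j ≡ j′ →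
               _≡_ {A = GHVertex H} (vedge i j p q) (vedge i′ j′ p′ q′)
  vedge-cong {p = p} {q} {p′} {q′} refl refl =
    cong₂ (vedge _ _) (<-irrelevant p p′) (T-irrelevant q q′)

  vtil-cong : ∀ {i i′ p p′} → i ≡ i′ → _≡_ {A = GHVertex H} (vtil i p) (vtil i′ p′)
  vtil-cong {p = p} {p′} refl = cong (vtil _) (ℕ.≡-irrelevant p p′)

  K-complete : ∀ u v → InK u → InK v → u ≢ v → GHAdj H u v
  K-complete (vedge _ _ _ _) (vedge _ _ _ _) _ _ u≢v = λ { (p , q) → u≢v (vedge-cong p q) }
  K-complete (vedge _ _ _ _) (vtil _ _)      _ _ _   = tt
  K-complete (vtil _ _)      (vedge _ _ _ _) _ _ _   = tt
  K-complete (vtil _ _)      (vtil _ _)      _ _ u≢v = u≢v ∘ vtil-cong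

  -- The colouring is partial: a surviving `vtx` must have a colour, and properness is asked only of
  -- surviving edges. This serves `G[ H ]` itself and both kinds of deletion.
  module _ {h : ℕ} (3≤h : 3 ≤ h) {A : Set} (ι : A → GHVertex H)
    (ι-injective : ∀ {a b} → ι a ≡ ι b → a ≡ b)
    (c : Fin n → Maybe (Fin h))
    (coloured : ∀ a {k} → ι a ≡ vtx k → ∃[ d ] c k ≡ just d)
    (proper : ∀ a {i j p q d} → ι a ≡ vedge i j p q → c i ≡ just d → c j ≢ just d)
    where
    open Caterpillars h n
    open Walks host
    open Gluing host

    inward : ∀ k → ∃[ L ] (Simple (encode (tip (c k) k)) (encode root) L × All (Region (c k) k) L)
    inward k = erase (arm (c k) k)

    outward : ∀ k → ∃[ L ] (Simple (encode root) (encode (tip (c k) k)) L × All (Region (c k) k) L)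
    outward k = erase (back (arm (c k) k))

    -- Members of the clique run through the root, and each `vtx` occupies only its own leaf, which
    -- exactly the members adjacent to it reach.
    route : GHVertex H → List (Fin N)
    route (vtx k)         = encode (tip (c k) k) ∷ []
    route (vedge i j _ _) = glue (proj₁ (inward i)) (proj₁ (outward j))
    route (vtil i _)      = proj₁ (outward i)

    regions-meet : ∀ {i j x} → (∀ {d} → c i ≡ just d → c j ≢ just d) →
                   Region (c i) i x → Region (c j) j x → x ≡ encode root
    regions-meet {x = x} ne r s = trans (sym (encode-decode x)) (cong encode (only (decode x) r s))
      where
      only : ∀ y → region (c _) _ y → region (c _) _ y → y ≡ root
      only root        _       _       = refl
      only (leaf _ _)  (p , _) (q , _) = contradiction q (ne p)
      only (spine _ _) p       q       = contradiction q (ne p)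

    route-path : ∀ a → IsPath host (route (ι a))
    route-path a with ι a in eq
    ... | vtx k       = [] ∷ [] , [-]
    ... | vtil i _    = Simple⇒IsPath (proj₁ (proj₂ (outward i)))
    ... | vedge i j _ _ = let _ , s , r = inward i ; _ , t , r′ = outward j in
      Simple⇒IsPath (glue-simple s t
        (λ x∈ x∈′ → regions-meet (proper a eq) (All.lookup r x∈) (All.lookup r′ x∈′)))

    ∈⇒nonempty : ∀ {x : Fin N} {L} → x ∈ L → 1 ≤ length L
    ∈⇒nonempty {L = _ ∷ _} _ = s≤s z≤n

    root∈ : ∀ w → InK w → encode root ∈ route w
    root∈ (vedge i j _ _) _ = ∈-glueʳ (proj₁ (inward i)) (head∈ (proj₁ (proj₂ (outward j))))
    root∈ (vtil i _)      _ = head∈ (proj₁ (proj₂ (outward i)))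

    route-nonempty : ∀ w → 1 ≤ length (route w)
    route-nonempty (vtx _)           = s≤s z≤n
    route-nonempty w@(vedge _ _ _ _) = ∈⇒nonempty (root∈ w tt)
    route-nonempty w@(vtil _ _)      = ∈⇒nonempty (root∈ w tt)

    tip∈ : ∀ w k → GHAdj H w (vtx k) → encode (tip (c k) k) ∈ route w
    tip∈ (vedge i j _ _) _ (inj₁ refl) = let _ , s , _ = inward i ; _ , t , _ = outward j in
      ∈-glueˡ s t (head∈ s)
    tip∈ (vedge i j _ _) _ (inj₂ refl) =
      ∈-glueʳ (proj₁ (inward i)) (last∈ (proj₁ (proj₂ (outward j))))
    tip∈ (vtil i _) _ refl = last∈ (proj₁ (proj₂ (outward i)))

    tip-region : ∀ {a i k d} → Region a i (encode (leaf d k)) → k ≡ i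
    tip-region {a} {i} {k} {d} r = proj₂ (subst (region a i) (decode-encode (leaf d k)) r)

    leaf∈⇒adj : ∀ w {k d} → InK w → encode (leaf d k) ∈ route w → GHAdj H w (vtx k)
    leaf∈⇒adj (vedge i j _ _) _ x∈ with ∈-glue⁻ (proj₁ (inward i)) x∈
    ... | inj₁ x∈ = inj₁ (tip-region {c i} (All.lookup (proj₂ (proj₂ (inward i))) x∈))
    ... | inj₂ x∈ = inj₂ (tip-region {c j} (All.lookup (proj₂ (proj₂ (outward j))) x∈))
    leaf∈⇒adj (vtil i _) _ x∈ = tip-region {c i} (All.lookup (proj₂ (proj₂ (outward i))) x∈)

    Meet : GHVertex H → GHVertex H → Set
    Meet u v = ∃[ x ] (x ∈ route u × x ∈ route v)

    K-vtx : ∀ w k {d} → InK w → c k ≡ just d →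
            (GHAdj H w (vtx k) → Meet w (vtx k)) × (Meet w (vtx k) → GHAdj H w (vtx k))
    K-vtx w k w∈ ck = (λ a → _ , tip∈ w k a , here refl) , back′
      where
      back′ : Meet w (vtx k) → GHAdj H w (vtx k)
      back′ (_ , x∈ , here refl) = leaf∈⇒adj w w∈
        (subst (λ m → encode (tip m k) ∈ route w) ck x∈)

    K-K : ∀ u v → InK u → InK v → u ≢ v →
          (GHAdj H u v → Meet u v) × (Meet u v → GHAdj H u v)
    K-K u v u∈ v∈ u≢v = (λ _ → _ , root∈ u u∈ , root∈ v v∈) , λ _ → K-complete u v u∈ v∈ u≢v

    vtx-K : ∀ k w {d} → InK w → c k ≡ just d →
            (GHAdj H (vtx k) w → Meet (vtx k) w) × (Meet (vtx k) w → GHAdj H (vtx k) w)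
    vtx-K k w w∈ ck with K-vtx w k w∈ ck
    ... | to , from =
      (λ a → let x , p , q = to (GHAdj-sym (vtx k) w a) in x , q , p) ,
      (λ { (x , p , q) → GHAdj-sym w (vtx k) (from (x , q , p)) })

    route-represents : ∀ a b → a ≢ b → (GHAdj H (ι a) (ι b) → Meet (ι a) (ι b)) ×
                                       (Meet (ι a) (ι b) → GHAdj H (ι a) (ι b))
    route-represents a b a≢b with ι a in eqa | ι b in eqb
    ... | vtx k | w@(vedge _ _ _ _) = vtx-K k w tt (proj₂ (coloured a eqa))
    ... | vtx k | w@(vtil _ _)      = vtx-K k w tt (proj₂ (coloured a eqa))
    ... | w@(vedge _ _ _ _) | vtx k = K-vtx w k tt (proj₂ (coloured b eqb))
    ... | w@(vtil _ _)      | vtx k = K-vtx w k tt (proj₂ (coloured b eqb))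
    ... | u@(vedge _ _ _ _) | v@(vedge _ _ _ _) =
      K-K u v tt tt λ e → a≢b (ι-injective (trans eqa (trans e (sym eqb))))
    ... | u@(vedge _ _ _ _) | v@(vtil _ _)      = K-K u v tt tt (λ ())
    ... | u@(vtil _ _)      | v@(vedge _ _ _ _) = K-K u v tt tt (λ ())
    ... | u@(vtil _ _)      | v@(vtil _ _)      =
      K-K u v tt tt λ e → a≢b (ι-injective (trans eqa (trans e (sym eqb))))
    ... | vtx k | vtx l = (λ ()) , λ { (x , here p , here q) → k≢l (trans (sym p) q) }
      where
      k≢l : encode (tip (c k) k) ≢ encode (tip (c l) l)
      k≢l e with c k | proj₂ (coloured a eqa) | c l | proj₂ (coloured b eqb)
      ... | just _ | _ | just _ | _ with encode-injective e
      ...   | refl = a≢b (ι-injective (trans eqa (sym eqb)))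

    representation : In[ h ,2,1] (pullback ι)
    representation = record
      { T-host = host ; isTree = host-tree ; maxDeg = maxDegree 3≤h
      ; P = route ∘ ι ; nonempty = route-nonempty ∘ ι ; isPath = route-path
      ; represents = route-represents }

-- Deletions in H and in G[ H ]

weaken : ∀ {G j k} → j ≤ k → Colorable G j → Colorable G k
weaken j≤k (c , proper) =
  (λ v → inject≤ (c v) j≤k) , λ u v uv eq → proper u v uv (inject≤-injective j≤k j≤k _ _ eq)

avoid₂ : ∀ {h} → 3 ≤ h → (a b : Fin h) → ∃[ d ] (d ≢ a × d ≢ b)
avoid₂ (s≤s (s≤s (s≤s _))) = go
  where
  go : ∀ {h} (a b : Fin (suc (suc (suc h)))) → ∃[ d ] (d ≢ a × d ≢ b)
  go zero          zero          = suc zero , (λ ()) , (λ ())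
  go zero          (suc zero)    = suc (suc zero) , (λ ()) , (λ ())
  go zero          (suc (suc _)) = suc zero , (λ ()) , (λ ())
  go (suc _)       (suc _)       = zero , (λ ()) , (λ ())
  go (suc zero)    zero          = suc (suc zero) , (λ ()) , (λ ())
  go (suc (suc _)) zero          = suc zero , (λ ()) , (λ ())

restrict : ∀ {h G} {A : Set} (f : A → V G) → (∀ {a b} → f a ≡ f b → a ≡ b) →
           In[ h ,2,1] G → In[ h ,2,1] (record { V = A ; Adj = λ a b → Adj G (f a) (f b) })
restrict f inj rep = record
  { T-host = T-host ; isTree = isTree ; maxDeg = maxDeg
  ; P = P ∘ f ; nonempty = nonempty ∘ f ; isPath = isPath ∘ f
  ; represents = λ a b a≢b → represents (f a) (f b) (a≢b ∘ inj) }
  where open VPTRep rep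

module _ (H : FinGraph) where
  open FinGraph H using (n; adj; irrefl)
  open Walks H using (E; E-sym; neighbours-of; E⇒∈nbrs; ∈nbrs⇒E)

  private
    Γ : Graph
    Γ = toGraph H

  E⇒≢ : ∀ {i j} → E i j → i ≢ j
  E⇒≢ e refl = irrefl _ e

  deg≡1⇒only : ∀ {i} → deg H i ≡ 1 → ∃[ j ] (E i j × ∀ {m} → E i m → m ≡ j)
  deg≡1⇒only {i} eq = go (neighbours-of i) eq ∈nbrs⇒E E⇒∈nbrs
    where
    go : ∀ L → length L ≡ 1 → (∀ {j} → j ∈ L → E i j) → (∀ {j} → E i j → j ∈ L) →
         ∃[ j ] (E i j × ∀ {m} → E i m → m ≡ j)
    go (j ∷ []) _ sound complete = j , sound (here refl) , λ e → only (complete e)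
      where
      only : ∀ {m} → m ∈ j ∷ [] → m ≡ j
      only (here eq) = eq

  only⇒deg≡1 : ∀ {i j} → E i j → (∀ {m} → E i m → m ≡ j) → deg H i ≡ 1
  only⇒deg≡1 {i} {j} e only =
    go (neighbours-of i) (filter⁺ (T? ∘ adj i) (allFin⁺ n)) (E⇒∈nbrs e) (only ∘ ∈nbrs⇒E)
    where
    go : ∀ L → Unique L → j ∈ L → (∀ {m} → m ∈ L → m ≡ j) → length L ≡ 1
    go (_ ∷ [])    _             _ _  = refl
    go (x ∷ y ∷ _) ((x≢y ∷ _) ∷ _) _ eq =
      contradiction (trans (eq (here refl)) (sym (eq (there (here refl))))) x≢y

  recolour : ∀ {h} i (c : Colorable (deleteVertex Γ i) h) (d : Fin h) →
             (∀ {m} (m≢i : m ≢ i) → E i m → proj₁ c (m , m≢i) ≢ d) → Colorable Γ h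
  recolour {h} i (c , proper) d free = colour , proper′
    where
    colour : Fin n → Fin h
    colour k with k ≟ i
    ... | yes _  = d
    ... | no k≢i = c (k , k≢i)

    proper′ : ∀ u v → E u v → colour u ≢ colour v
    proper′ u v uv with u ≟ i | v ≟ i
    ... | yes refl | yes refl = contradiction uv (irrefl i)
    ... | yes refl | no v≢i   = λ eq → free v≢i uv (sym eq)
    ... | no u≢i   | yes refl = free u≢i (E-sym uv)
    ... | no u≢i   | no v≢i   = proper (u , u≢i) (v , v≢i) uv

  colour-back-vertex : ∀ {k} i → Colorable (deleteVertex Γ i) k → Colorable Γ (suc k)
  colour-back-vertex i (c , proper) =
    recolour i (suc ∘ c , λ u v uv eq → proper u v uv (Fin.suc-injective eq)) zero (λ _ _ ())

  -- The missing edge is incident with `i`, so the colouring restricts to `deleteVertex Γ i`.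
  colour-back-edge : ∀ {k} i j → Colorable (deleteEdge Γ i j) k → Colorable Γ (suc k)
  colour-back-edge {k} i j (c , proper) =
    colour-back-vertex i (c ∘ proj₁ , λ { (u , u≢i) (v , v≢i) uv → proper u v
      (uv , λ { (inj₁ (u≡i , _)) → u≢i u≡i ; (inj₂ (_ , v≡i)) → v≢i v≡i }) })

  -- Otherwise all neighbours of `i` are among `j` and `k`; a third colour, different from theirs,
  -- is then free for `i` and extends `c` to all of `H`.
  further-neighbour : ∀ {h} → 3 ≤ h → ¬ Colorable Γ h → ∀ i → Colorable (deleteVertex Γ i) h →
                      ∀ j k → j ≢ i → k ≢ i → ∃[ m ] (E i m × m ≢ j × m ≢ k)
  further-neighbour 3≤h ¬col i c j k j≢i k≢i
    with any? (λ m → T? (adj i m) ×-dec ¬? (m ≟ j) ×-dec ¬? (m ≟ k))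
  ... | yes found = found
  ... | no none with avoid₂ 3≤h (proj₁ c (j , j≢i)) (proj₁ c (k , k≢i))
  ...   | d , d≢j , d≢k = contradiction (recolour i c d free) ¬col
    where
    free : ∀ {m} (m≢i : m ≢ i) → E i m → proj₁ c (m , m≢i) ≢ d
    free {m} m≢i im eq with m ≟ j | m ≟ k
    ... | yes refl | _        = d≢j (sym eq)
    ... | no _     | yes refl = d≢k (sym eq)
    ... | no m≢j   | no m≢k   = none (m , im , m≢j , m≢k)

  -- Hides the orientation that `vedge` imposes by `i < j`.
  edge : ∀ i j → E i j → GHVertex H
  edge i j e with <-cmp i j
  ... | tri< i<j _ _  = vedge i j i<j e
  ... | tri≈ _ refl _ = contradiction e (irrefl i)
  ... | tri> _ _ j<i  = vedge j i j<i (E-sym e)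

  edge-InK : ∀ i j e → InK H (edge i j e)
  edge-InK i j e with <-cmp i j
  ... | tri< _ _ _    = tt
  ... | tri≈ _ refl _ = contradiction e (irrefl i)
  ... | tri> _ _ _    = tt

  edge-end₁ : ∀ i j e → GHAdj H (edge i j e) (vtx i)
  edge-end₁ i j e with <-cmp i j
  ... | tri< _ _ _    = inj₁ refl
  ... | tri≈ _ refl _ = contradiction e (irrefl i)
  ... | tri> _ _ _    = inj₂ refl

  edge-end₂ : ∀ i j e → GHAdj H (edge i j e) (vtx j)
  edge-end₂ i j e with <-cmp i j
  ... | tri< _ _ _    = inj₂ refl
  ... | tri≈ _ refl _ = contradiction e (irrefl i)
  ... | tri> _ _ _    = inj₁ refl

  edge-ends : ∀ i j e {k} → GHAdj H (edge i j e) (vtx k) → k ≡ i ⊎ k ≡ j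
  edge-ends i j e a with <-cmp i j
  ... | tri< _ _ _    = a
  ... | tri≈ _ refl _ = contradiction e (irrefl i)
  ... | tri> _ _ _ with a
  ...   | inj₁ p = inj₂ p
  ...   | inj₂ p = inj₁ p

  -- An edge from `l` to a neighbour other than `k` serves; if there is none, `l` has degree one,
  -- and `vtil l` exists for this case.
  exclusive-vertex : ∀ {k l} → E k l → ∃[ w ] (InK H w × GHAdj H w (vtx l) × ¬ GHAdj H w (vtx k))
  exclusive-vertex {k} {l} kl with any? (λ m → T? (adj l m) ×-dec ¬? (m ≟ k))
  ... | yes (m , lm , m≢k) = edge l m lm , edge-InK l m lm , edge-end₁ l m lm , ¬k
    where
    ¬k : ¬ GHAdj H (edge l m lm) (vtx k)
    ¬k a with edge-ends l m lm a
    ... | inj₁ k≡l = E⇒≢ kl k≡l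
    ... | inj₂ k≡m = m≢k (sym k≡m)
  ... | no none = vtil l (only⇒deg≡1 (E-sym kl) only) , tt , refl , E⇒≢ kl
    where
    only : ∀ {m} → E l m → m ≡ k
    only {m} lm with m ≟ k
    ... | yes m≡k = m≡k
    ... | no m≢k  = contradiction (m , lm , m≢k) none

  infix 4 _≟ᴳ_
  _≟ᴳ_ : DecidableEquality (GHVertex H)
  vtx i ≟ᴳ vtx j with i ≟ j
  ... | yes refl = yes refl
  ... | no i≢j   = no λ { refl → i≢j refl }
  vedge i j _ _ ≟ᴳ vedge k l _ _ with i ≟ k | j ≟ l
  ... | yes p  | yes q  = yes (vedge-cong H p q)
  ... | no i≢k | _      = no λ { refl → i≢k refl }
  ... | yes _  | no j≢l = no λ { refl → j≢l refl }
  vtil i _ ≟ᴳ vtil j _ with i ≟ j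
  ... | yes p  = yes (vtil-cong H p)
  ... | no i≢j = no λ { refl → i≢j refl }
  vtx _         ≟ᴳ vedge _ _ _ _ = no λ ()
  vtx _         ≟ᴳ vtil _ _      = no λ ()
  vedge _ _ _ _ ≟ᴳ vtx _         = no λ ()
  vedge _ _ _ _ ≟ᴳ vtil _ _      = no λ ()
  vtil _ _      ≟ᴳ vtx _         = no λ ()
  vtil _ _      ≟ᴳ vedge _ _ _ _ = no λ ()

  when : ∀ {A B : Set} → Dec A → (A → B) → List B
  when (yes a) f = f a ∷ []
  when (no _)  f = []

  -- The decision may hold another proof than `a`, hence the demand that `f` be constant.
  ∈-when : ∀ {A B : Set} (a? : Dec A) {f : A → B} {b} (a : A) → (∀ a → f a ≡ b) → b ∈ when a? f
  ∈-when (yes a) _ eq = here (sym (eq a))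
  ∈-when (no ¬a) a _  = contradiction a ¬a

  K-list : List (GHVertex H)
  K-list = concatMap (λ i →
    when (deg H i ℕ.≟ 1) (vtil i) ++
    concatMap (λ j → when ((i <? j) ×-dec T? (adj i j)) (λ (p , q) → vedge i j p q)) (allFin n))
    (allFin n)

  K-listed : ∀ w → InK H w → w ∈ K-list
  K-listed (vtil i p) _ = ∈-concatMap⁺ _ (lose (∈-allFin i)
    (∈-++⁺ˡ (∈-when (deg H i ℕ.≟ 1) p (λ _ → vtil-cong H refl))))
  K-listed (vedge i j p q) _ = ∈-concatMap⁺ _ (lose (∈-allFin i)
    (∈-++⁺ʳ (when (deg H i ℕ.≟ 1) (vtil i)) (∈-concatMap⁺ _ (lose (∈-allFin j)
      (∈-when ((i <? j) ×-dec T? (adj i j)) (p , q) (λ _ → vedge-cong H refl refl))))))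

  InK? : ∀ w → Dec (InK H w)
  InK? (vtx _)         = no id
  InK? (vedge _ _ _ _) = yes tt
  InK? (vtil _ _)      = yes tt

  InK-irrelevant : ∀ w (p q : InK H w) → p ≡ q
  InK-irrelevant (vedge _ _ _ _) _ _ = refl
  InK-irrelevant (vtil _ _)      _ _ = refl

  -- `D` selects the surviving vertices of `G[ H ]` and `B` is the graph to be coloured. The
  -- surviving part of the clique still has to provide, for each edge of `B`, its own vertex and an
  -- exclusive neighbour of either end.
  representable⇒colourable : ∀ {h} → 1 ≤ h →
    (D : GHVertex H → Set) (D? : ∀ w → Dec (D w)) (D-irrelevant : ∀ {w} (p q : D w) → p ≡ q) →
    In[ h ,2,1] (pullback H {Σ (GHVertex H) D} proj₁) →
    (B : Graph) (B-sym : ∀ {b c} → Adj B b c → Adj B c b)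
    (β : V B → Fin n) (β∈ : ∀ b → D (vtx (β b)))
    (edge∈ : ∀ {b c} → Adj B b c → ∃[ e ] D (edge (β b) (β c) e))
    (exclusive∈ : ∀ {b c} → Adj B b c →
      ∃[ w ] (InK H w × D w × GHAdj H w (vtx (β c)) × ¬ GHAdj H w (vtx (β b)))) →
    Colorable B h
  representable⇒colourable 1≤h D D? D-irrelevant rep B B-sym β β∈ edge∈ exclusive∈ =
    branchColouring rep 1≤h member members listed clique B B-sym (λ b → vtx (β b) , β∈ b)
      distinct stable common
      (λ bc → let w , k , d , c , ¬b = exclusive∈ bc in (w , k , d) , c , ¬b)
    where
    I : Set
    I = Σ (GHVertex H) λ w → InK H w × D w

    member : I → Σ (GHVertex H) D
    member (w , _ , d) = w , d

    members : List I
    members = concatMap (λ w → when (InK? w ×-dec D? w) (w ,_)) K-list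

    listed : ∀ i → i ∈ members
    listed (w , k , d) = ∈-concatMap⁺ _ (lose (K-listed w k) (∈-when (InK? w ×-dec D? w) (k , d)
      (λ (k′ , d′) → cong (w ,_) (cong₂ _,_ (InK-irrelevant w k′ k) (D-irrelevant d′ d)))))

    clique : ∀ i j → member i ≡ member j ⊎
             (member i ≢ member j × GHAdj H (proj₁ i) (proj₁ j))
    clique (w , k , d) (w′ , k′ , d′) with w ≟ᴳ w′
    ... | yes refl = inj₁ (cong (w ,_) (D-irrelevant d d′))
    ... | no w≢w′  = inj₂ ((λ { refl → w≢w′ refl }) , K-complete H w w′ k k′ w≢w′)

    distinct : ∀ b i → member i ≢ (vtx (β b) , β∈ b)
    distinct b (vtx _ , k , _) _ = k

    stable : ∀ {b c} → Adj B b c → (Σ (GHVertex H) D ∋ (vtx (β b) , β∈ b)) ≢ (vtx (β c) , β∈ c) × ¬ ⊥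
    stable bc = (λ eq → E⇒≢ (proj₁ (edge∈ bc)) (vtx-injective (cong proj₁ eq))) , id
      where
      vtx-injective : ∀ {i j} → vtx i ≡ vtx j → i ≡ j
      vtx-injective refl = refl

    common : ∀ {b c} → Adj B b c →
             ∃[ i ] (GHAdj H (proj₁ i) (vtx (β b)) × GHAdj H (proj₁ i) (vtx (β c)))
    common bc = let e , d = edge∈ bc in
      (edge _ _ e , edge-InK _ _ e , d) , edge-end₁ _ _ e , edge-end₂ _ _ e

  -- Minimality of `G[ H ]` and criticality of `H`

  module _ {h} (3≤h : 3 ≤ h) where

    private
      1≤h : 1 ≤ h
      1≤h = ≤-trans (s≤s z≤n) 3≤h

    InK⇒≢vtx : ∀ {w i} → InK H w → w ≢ vtx i
    InK⇒≢vtx k refl = k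

    -- Negations are equal by refl since Data.Empty.⊥ is definitionally irrelevant;
    -- this supplies the D-irrelevant argument for D = (_≢ v).
    _≢?_ : ∀ w v → Dec (w ≢ v)
    w ≢? v = ¬? (w ≟ᴳ v)

    whole : In[ h ,2,1] G[ H ] → Colorable Γ h
    whole rep = representable⇒colourable 1≤h (λ _ → ⊤) (λ _ → yes tt) (λ _ _ → refl)
      (restrict proj₁ (λ { refl → refl }) rep) Γ E-sym id _ (λ e → e , tt)
      (λ bc → let w , k , c , ¬b = exclusive-vertex bc in w , k , tt , c , ¬b)

    minus-vertex : ∀ i → In[ h ,2,1] (deleteVertex G[ H ] (vtx i)) → Colorable (deleteVertex Γ i) h
    minus-vertex i rep = representable⇒colourable 1≤h (_≢ vtx i) (_≢? vtx i) (λ _ _ → refl) rep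
      (deleteVertex Γ i) E-sym proj₁ (λ { (_ , k≢i) refl → k≢i refl })
      (λ {b} {c} e → e , InK⇒≢vtx (edge-InK (proj₁ b) (proj₁ c) e))
      (λ bc → let w , k , c , ¬b = exclusive-vertex bc in w , k , InK⇒≢vtx k , c , ¬b)

    minus-edge : ¬ Colorable Γ h → (∀ i → Colorable (deleteVertex Γ i) h) → ∀ i j e →
                 In[ h ,2,1] (deleteVertex G[ H ] (edge i j e)) → Colorable (deleteEdge Γ i j) h
    minus-edge ¬col col i j ij rep = representable⇒colourable 1≤h
      (_≢ edge i j ij) (_≢? edge i j ij) (λ _ _ → refl) rep (deleteEdge Γ i j)
      (λ { (e , ¬ij) → E-sym e , λ { (inj₁ (p , q)) → ¬ij (inj₂ (q , p))
                                   ; (inj₂ (p , q)) → ¬ij (inj₁ (q , p)) } })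
      id (λ k eq → InK⇒≢vtx (edge-InK i j ij) (sym eq)) survives another
      where
      -- The ends are the neighbours of the form `vtx`, so they can be read off by adjacency without
      -- comparing orientations.
      same-ends : ∀ {k l e} → edge k l e ≡ edge i j ij → (k ≡ i × l ≡ j) ⊎ (k ≡ j × l ≡ i)
      same-ends {k} {l} {e} eq
        with edge-ends i j ij (subst (λ w → GHAdj H w (vtx k)) eq (edge-end₁ k l e))
           | edge-ends i j ij (subst (λ w → GHAdj H w (vtx l)) eq (edge-end₂ k l e))
      ... | inj₁ p | inj₂ q = inj₁ (p , q)
      ... | inj₂ p | inj₁ q = inj₂ (p , q)
      ... | inj₁ p | inj₁ q = contradiction (trans p (sym q)) (E⇒≢ e)
      ... | inj₂ p | inj₂ q = contradiction (trans p (sym q)) (E⇒≢ e)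

      survives : ∀ {k l} → Adj (deleteEdge Γ i j) k l → ∃[ e ] edge k l e ≢ edge i j ij
      survives (e , ¬ij) = e , ¬ij ∘ same-ends

      -- The wanted edge at `l` must differ from the deleted one as well as avoid `k`;
      -- `further-neighbour` excludes both `k` and the other end of the deleted edge.
      another : ∀ {k l} → Adj (deleteEdge Γ i j) k l →
        ∃[ w ] (InK H w × w ≢ edge i j ij × GHAdj H w (vtx l) × ¬ GHAdj H w (vtx k))
      another {k} {l} (kl , _) = through (opposite l)
        where
        opposite : ∀ l → ∃[ o ] (o ≢ l × (∀ {m} → (l ≡ i × m ≡ j) ⊎ (l ≡ j × m ≡ i) → m ≡ o))
        opposite l with l ≟ i
        ... | yes refl = j , E⇒≢ ij ∘ sym , λ { (inj₁ (_ , q)) → q ; (inj₂ (p , q)) → trans q p }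
        -- Right for `l ≡ j`; if `l` is on neither end, this only excludes one vertex more.
        ... | no l≢i   = i , l≢i ∘ sym , λ { (inj₁ (p , _)) → contradiction p l≢i ; (inj₂ (_ , q)) → q }

        through : _ → _
        through (o , o≢l , to-o) with further-neighbour 3≤h ¬col l (col l) k o (E⇒≢ kl) o≢l
        ... | m , lm , m≢k , m≢o = edge l m lm , edge-InK l m lm , m≢o ∘ to-o ∘ same-ends ,
          edge-end₁ l m lm , λ a → not-k (edge-ends l m lm a)
          where
          not-k : ¬ (k ≡ l ⊎ k ≡ m)
          not-k (inj₁ k≡l) = E⇒≢ kl k≡l
          not-k (inj₂ k≡m) = m≢k (sym k≡m)

    colourable⇒representable : Colorable Γ h → In[ h ,2,1] G[ H ]
    colourable⇒representable (c , proper) =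
      representation H 3≤h id id (just ∘ c) (λ _ _ → _ , refl)
        (λ { _ {q = ij} refl p q → proper _ _ ij (just-injective (trans p (sym q))) })

    deleted-vtx : ∀ i → Colorable (deleteVertex Γ i) h → In[ h ,2,1] (deleteVertex G[ H ] (vtx i))
    deleted-vtx i (c , proper) = representation H 3≤h proj₁ (λ { refl → refl }) colour coloured
      (λ { _ {q = kl} refl → proper′ _ _ kl })
      where
      colour : Fin n → Maybe (Fin h)
      colour k with k ≟ i
      ... | yes _  = nothing
      ... | no k≢i = just (c (k , k≢i))

      coloured : (a : Σ (GHVertex H) (_≢ vtx i)) → ∀ {k} → proj₁ a ≡ vtx k → ∃[ d ] colour k ≡ just d
      coloured (_ , a≢) {k} refl with k ≟ i
      ... | yes refl = contradiction refl a≢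
      ... | no _     = _ , refl

      proper′ : ∀ k l → E k l → ∀ {d} → colour k ≡ just d → colour l ≢ just d
      proper′ k l kl p q with k ≟ i | l ≟ i
      ... | no k≢i | no l≢i = proper _ _ kl (just-injective (trans p (sym q)))

    deleted-vedge : ∀ i j p q → Colorable (deleteEdge Γ i j) h →
                    In[ h ,2,1] (deleteVertex G[ H ] (vedge i j p q))
    deleted-vedge i j i<j _ (c , proper) =
      representation H 3≤h proj₁ (λ { refl → refl }) (just ∘ c) (λ _ _ → _ , refl)
        λ { (_ , w≢) {p = k<l} {q = kl} refl p q → proper _ _
          (kl , λ { (inj₁ (refl , refl)) → w≢ (vedge-cong H refl refl)
                  ; (inj₂ (refl , refl)) → <-asym i<j k<l })
          (just-injective (trans p (sym q))) }

    -- Excluding the only neighbour twice still yields a further one. Thus `G[ H ]` has no `vtil`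
    -- whose deletion would have to be treated.
    no-leaf : ¬ Colorable Γ h → ∀ i → Colorable (deleteVertex Γ i) h → deg H i ≢ 1
    no-leaf ¬col i c d with deg≡1⇒only d
    ... | j , ij , only with further-neighbour 3≤h ¬col i c j j (E⇒≢ ij ∘ sym) (E⇒≢ ij ∘ sym)
    ...   | m , im , m≢j , _ = m≢j (only im)

    -- With fewer than `h` colours on `G`, `back` would colour `Γ` with at most `h`.
    exact : ∀ G → ¬ Colorable Γ h → Colorable G h → (∀ {k} → Colorable G k → Colorable Γ (suc k)) →
            ∃[ j ] (j < suc h × HasChromaticNumber G j)
    exact G ¬col c back = h , n<1+n h , c , λ j j<h d → ¬col (weaken j<h (back d))

    minimal⇒critical : Connected H → MinimalNon[ h ,2,1] G[ H ] → Critical (suc h) Γ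
    minimal⇒critical (1≤n , _) (¬rep , deleted) =
      -- Connectedness supplies a vertex; one new colour for it extends an `h`-colouring of the
      -- rest.
      (colour-back-vertex (fromℕ< 1≤n) (vertexwise (fromℕ< 1≤n)) ,
        λ { j (s≤s j≤h) c → ¬col (weaken j≤h c) }) ,
      (λ i → exact _ ¬col (vertexwise i) (colour-back-vertex i)) ,
      (λ i j e → exact _ ¬col (minus-edge ¬col vertexwise i j e (deleted (edge i j e)))
        (colour-back-edge i j))
      where
      ¬col : ¬ Colorable Γ h
      ¬col = ¬rep ∘ colourable⇒representable

      vertexwise : ∀ i → Colorable (deleteVertex Γ i) h
      vertexwise i = minus-vertex i (deleted (vtx i))

    critical⇒minimal : Critical (suc h) Γ → MinimalNon[ h ,2,1] G[ H ]
    critical⇒minimal ((_ , least) , vertices , edges) = ¬col ∘ whole , deleted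
      where
      ¬col : ¬ Colorable Γ h
      ¬col = least h (n<1+n h)

      below : ∀ {G} → ∃[ j ] (j < suc h × HasChromaticNumber G j) → Colorable G h
      below (_ , s≤s j≤h , c , _) = weaken j≤h c

      vertexwise : ∀ i → Colorable (deleteVertex Γ i) h
      vertexwise i = below (vertices i)

      deleted : ∀ v → In[ h ,2,1] (deleteVertex G[ H ] v)
      deleted (vtx i)         = deleted-vtx i (vertexwise i)
      deleted (vedge i j p q) = deleted-vedge i j p q (below (edges i j q))
      deleted (vtil i d)      = contradiction d (no-leaf ¬col i (vertexwise i))

theorem18 : (h : ℕ) → 3 ≤ h → (H : FinGraph) → Connected H →
    MinimalNon[ h ,2,1] G[ H ] ⇔ Critical (suc h) (toGraph H)
theorem18 h 3≤h H conn = mk⇔ (minimal⇒critical H 3≤h conn) (critical⇒minimal H 3≤h)
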